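{- For every $\varepsilon>0$ there exists a two-player protocol for the problem Max-Card-$k$ (in the two-player model described in the context) with an approximation guarantee of $\frac{2}{3}-\varepsilon$ whose communication complexity is $\widetilde{O}(k/\varepsilon)$ elements. Moreover, there exists such a protocol achieving an approximation guarantee of $\frac{2}{3}$ whose communication complexity is $O(k^2)$ elements.
   Context: Two-player model for Max-Card-$k$. The global information known to both players consists of a positive integer $k$, a finite ground set $W$, and a partition $W=W_A\,\dot\cup\, W_B$. Alice privately receives a set $V_A\subseteq W_A$ and Bob privately receives a set $V_B\subseteq W_B$. There is a non-negative, monotone, submodular function $f:2^W\to\mathbb{R}_{\ge 0}$; Alice can query $f$ (via a value oracle) only on subsets of $W_A$, while Bob can query $f$ on any subset of $W$. A protocol consists of two possibly randomized algorithms: Alice's algorithm computes a message $m$ from the global information, $V_A$ and her oracle; then Bob's algorithm computes an output set $S\subseteq V_A\cup V_B$ with $|S|\le k$ from the global information, $V_B$, $m$ and his oracle. The communication complexity is the maximum length of $m$ over all inputs and the randomness; when the message consists of elements of $W$, it is measured in elements (number of elements of $W$ in $m$). The protocol has approximation guarantee $\rho$ if for every instance $\mathbb{E}[f(S)]\ge \rho\cdot\max\{f(T): T\subseteq V_A\cup V_B,\ |T|\le k\}$. A monotone submodular $f$ means $f(X)\le f(Y)$ for $X\subseteq Y$ and $f(X\cup\{v\})-f(X)\ge f(Y\cup\{v\})-f(Y)$ for $X\subseteq Y\subseteq W$, $v\notin Y$. $\widetilde{O}$ suppresses poly-logarithmic factors. No bound on computation time is required. -}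

module Defs where

open import Algebra.Bundles using (CommutativeRing)
open import Algebra.Structures using (IsCommutativeRing)
open import Data.Fin using (Fin)
open import Data.Fin.Subset using (Subset; _∉_; _⊆_; _∪_; _∩_; ⁅_⁆; ∣_∣; ⊤; ⊥)
open import Data.List using (List; map; foldr; length)
open import Data.List.Membership.Propositional using () renaming (_∈_ to _∈ˡ_)
open import Data.List.Relation.Unary.All using (All)
open import Data.Nat as ℕ using (ℕ)
open import Data.Nat.Logarithm using (⌈log₂_⌉)
open import Data.Product using (∃; _×_; _,_; proj₁; proj₂)
open import Level using (0ℓ)
open import Relation.Binary.PropositionalEquality using (_≡_; _≢_)
open import Relation.Binary.Structures using (IsDecTotalOrder)
import Algebra.Definitions.RawMonoid as RawMonoidDefs

-- The real numbers, given axiomatically as a Dedekind-complete ordered field.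
-- Decidability of _≤_ is the classical trichotomy of ℝ.  These axioms
-- determine ℝ up to isomorphism (classically).
record RealNumbers : Set₁ where
  infix  8 _⁻¹
  infixl 7 _*_ _/_
  infixl 6 _+_ _-_
  infix  4 _≤_ _<_
  field
    ℝ                 : Set
    _+_ _*_           : ℝ → ℝ → ℝ
    -_                : ℝ → ℝ
    0# 1#             : ℝ
    isCommutativeRing : IsCommutativeRing _≡_ _+_ _*_ -_ 0# 1#
    0≢1               : 0# ≢ 1#
    -- The value of 0# ⁻¹ is left unspecified.
    _⁻¹               : ℝ → ℝ
    ⁻¹-inverse        : ∀ {x} → x ≢ 0# → x * x ⁻¹ ≡ 1#
    _≤_               : ℝ → ℝ → Set
    isDecTotalOrder   : IsDecTotalOrder _≡_ _≤_
    +-monoˡ-≤         : ∀ z {x y} → x ≤ y → x + z ≤ y + z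
    *-nonNegative     : ∀ {x y} → 0# ≤ x → 0# ≤ y → 0# ≤ x * y

  commutativeRing : CommutativeRing 0ℓ 0ℓ
  commutativeRing = record { isCommutativeRing = isCommutativeRing }

  open RawMonoidDefs (CommutativeRing.+-rawMonoid commutativeRing)
    using () renaming (_×_ to _×ʳ_)

  ι : ℕ → ℝ
  ι n = n ×ʳ 1#

  UpperBound : (ℝ → Set) → ℝ → Set
  UpperBound P u = ∀ x → P x → x ≤ u

  field
    -- The ceiling into ℕ, i.e. max(0, ⌈x⌉).  It is the Archimedean property,
    -- which follows from completeness only non-constructively.
    ⌈_⌉          : ℝ → ℕ
    x≤⌈x⌉        : ∀ x → x ≤ ι ⌈ x ⌉
    ⌈⌉-least     : ∀ x n → x ≤ ι n → ⌈ x ⌉ ℕ.≤ n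
    completeness : ∀ (P : ℝ → Set) → ∃ P → ∃ (UpperBound P) →
                   ∃ λ s → UpperBound P s × (∀ u → UpperBound P u → s ≤ u)

  _-_ _/_ : ℝ → ℝ → ℝ
  x - y = x + (- y)
  x / y = x * y ⁻¹

  _<_ : ℝ → ℝ → Set
  x < y = x ≤ y × x ≢ y

module TwoPlayer (R : RealNumbers) where
  open RealNumbers R

  2/3 : ℝ
  2/3 = ι 2 / ι 3

  sum : List ℝ → ℝ
  sum = foldr _+_ 0#

  -- Finitely supported probability distributions: a list of outcomes with
  -- their probabilities (the same outcome may be listed more than once).
  record Distribution (A : Set) : Set where
    field
      weighted   : List (ℝ × A)
      positive   : All (λ px → 0# < proj₁ px) weighted
      normalised : sum (map proj₁ weighted) ≡ 1#

  open Distribution public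

  _∈supp_ : {A : Set} → A → Distribution A → Set
  x ∈supp D = x ∈ˡ map proj₂ (weighted D)

  𝔼 : {A : Set} → Distribution A → (A → ℝ) → ℝ
  𝔼 D g = sum (map (λ (p , x) → p * g x) (weighted D))

  NonNegative Monotone Submodular : ∀ {n} → (Subset n → ℝ) → Set
  NonNegative f = ∀ X → 0# ≤ f X
  Monotone    f = ∀ X Y → X ⊆ Y → f X ≤ f Y
  Submodular  f = ∀ X Y v → X ⊆ Y → v ∉ Y →
                  f (Y ∪ ⁅ v ⁆) - f Y ≤ f (X ∪ ⁅ v ⁆) - f X

  -- The ground set W is Fin n.
  record Global : Set where
    field
      k        : ℕ
      k>0      : 0 ℕ.< k
      n        : ℕ
      W-A W-B  : Subset n
      covering : W-A ∪ W-B ≡ ⊤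
      disjoint : W-A ∩ W-B ≡ ⊥

    Message : Set
    Message = List (Fin n)

    OracleA OracleB : Set
    OracleA = (X : Subset n) → X ⊆ W-A → ℝ
    OracleB = Subset n → ℝ

  record Instance (G : Global) : Set where
    open Global G
    field
      V-A V-B     : Subset n
      V-A⊆W-A     : V-A ⊆ W-A
      V-B⊆W-B     : V-B ⊆ W-B
      f           : Subset n → ℝ
      nonNegative : NonNegative f
      monotone    : Monotone f
      submodular  : Submodular f

    oracleA : OracleA
    oracleA X _ = f X

    oracleB : OracleB
    oracleB = f

    Feasible : Subset n → Set
    Feasible S = S ⊆ V-A ∪ V-B × ∣ S ∣ ℕ.≤ k

    IsOptimum : ℝ → Set
    IsOptimum opt = (∃ λ T → Feasible T × f T ≡ opt) × (∀ T → Feasible T → f T ≤ opt)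

  AliceAlgorithm BobAlgorithm : Set
  AliceAlgorithm = (G : Global) → let open Global G in
                   (V-A : Subset n) → V-A ⊆ W-A → OracleA → Distribution Message
  BobAlgorithm   = (G : Global) → let open Global G in
                   (V-B : Subset n) → V-B ⊆ W-B → OracleB → Message → Distribution (Subset n)

  -- The two players use independent (private) randomness.
  record Protocol : Set where
    field
      alice : AliceAlgorithm
      bob   : BobAlgorithm

    message : ∀ G → Instance G → Distribution (Global.Message G)
    message G I = let open Instance I in alice G V-A V-A⊆W-A oracleA

    output : ∀ G → Instance G → Global.Message G → Distribution (Subset (Global.n G))
    output G I m = let open Instance I in bob G V-B V-B⊆W-B oracleB m

    field
      feasible : ∀ G (I : Instance G) m S → m ∈supp message G I → S ∈supp output G I m →
                 Instance.Feasible I S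

    expectedValue : ∀ G → Instance G → ℝ
    expectedValue G I = 𝔼 (message G I) λ m → 𝔼 (output G I m) (Instance.f I)

  HasApproximationGuarantee : Protocol → ℝ → Set
  HasApproximationGuarantee Π ρ =
    ∀ G (I : Instance G) opt → Instance.IsOptimum I opt → ρ * opt ≤ Protocol.expectedValue Π G I

  -- Communication measured in elements, bounded by a function of k.
  HasCommunicationAtMost : Protocol → (ℕ → ℝ) → Set
  HasCommunicationAtMost Π b =
    ∀ G (I : Instance G) m → m ∈supp Protocol.message Π G I → ι (length m) ≤ b (Global.k G)

  -- Õ(x) with explicit constants: C · x · (1 + log x)^c.
  polylogBound : (C c : ℕ) → ℝ → ℝ
  polylogBound C c x = ι C * x * ι ((1 ℕ.+ ⌈log₂ ⌈ x ⌉ ⌉) ℕ.^ c)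

{-# OPTIONS --safe #-}
module Submission where

-- For a guess i of how many elements of the optimum O = X ∪ Y belong to Alice
-- (X) rather than to Bob (Y), Alice sends a best set M₁ of at most i of her
-- elements and a set M₂ of at most i elements maximising f(M₁ ∪ M₂); Bob answers
-- with a best feasible set he knows.  If |X| ≤ i and |Y| ≤ k - i, then M₁ ∪ Y and
-- M₂ ∪ Y are feasible, and submodularity gives
--     2 f(M₁ ∪ Y) + f(M₂ ∪ Y) ≥ 2 f(O).
-- Sending all guesses 0, …, k costs O(k²) elements.  With guesses only at
-- multiples of about εk / 2, and at k minus these multiples, O(k/ε) elements
-- suffice: the larger part of O, of at least k / 2 elements, is trimmed to the
-- next multiple by dropping its cheapest elements, which loses an O(ε) fraction.

open import Defs
open import Data.Nat using (ℕ; _^_) renaming (_*_ to _*ℕ_)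
open import Data.Product using (∃; ∃₂; _×_)

open import Algebra.Bundles using (CommutativeRing)
open import Data.Fin using (Fin; zero; suc)
open import Data.Fin.Subset using (Subset; inside; outside; _∈_; _⊆_; _∪_; _∩_; ∁; ⁅_⁆; ∣_∣; ⊥)
open import Data.Fin.Subset.Properties
open import Data.List using (List; []; _∷_; map; _++_; length; filter; concatMap; upTo)
open import Data.List.Membership.Propositional using (lose) renaming (_∈_ to _∈ˡ_)
open import Data.List.Membership.Propositional.Properties
open import Data.List.Properties using (length-map; length-++; length-upTo)
open import Data.List.Relation.Unary.All as All using (All; []; _∷_)
open import Data.List.Relation.Unary.All.Properties using (++⁺; map⁺)
open import Data.List.Relation.Unary.Any using (here; there; satisfied)
open import Data.Nat as ℕ using (zero; suc; z≤n; s≤s; _∸_; pred) renaming (_+_ to _+ℕ_; _≤_ to _≤ℕ_)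
open import Data.Nat.DivMod using (_%_; m≡m%n+[m/n]*n; m%n<n; m/n*n≤m; /-monoˡ-≤; n/1≡n) renaming (_/_ to _/ℕ_)
import Data.Nat.Properties as ℕₚ
open import Data.Product using (_,_; proj₁; proj₂)
open import Data.Sum using (inj₁; inj₂; [_,_]′)
open import Data.Vec using ([]; _∷_; here; there)
open import Function using (_∘_; id)
open import Relation.Binary.Bundles using (TotalOrder)
open import Relation.Binary.PropositionalEquality using (_≡_; refl; sym; trans; cong; cong₂; subst; subst₂)
open import Relation.Binary.Structures using (IsDecTotalOrder)
open import Relation.Nullary using (yes; no; contradiction)
open import Relation.Nullary.Decidable using (_×-dec_)
open import Relation.Unary using (Decidable)
import Algebra.Properties.Semiring.Mult as SemiringMult
import Algebra.Properties.Ring as RingProperties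
import Algebra.Solver.Ring.NaturalCoefficients.Default as SemiringSolver
import Data.List.Extrema as Extrema
import Relation.Binary.Reasoning.PartialOrder as PartialOrderReasoning
import Data.Nat.Solver as ℕSolver

-- Finite sets

∣p∪q∣≤∣p∣+∣q∣ : ∀ {n} (p q : Subset n) → ∣ p ∪ q ∣ ≤ℕ ∣ p ∣ +ℕ ∣ q ∣
∣p∪q∣≤∣p∣+∣q∣ []            []            = z≤n
∣p∪q∣≤∣p∣+∣q∣ (outside ∷ p) (outside ∷ q) = ∣p∪q∣≤∣p∣+∣q∣ p q
∣p∪q∣≤∣p∣+∣q∣ (inside  ∷ p) (outside ∷ q) = s≤s (∣p∪q∣≤∣p∣+∣q∣ p q)
∣p∪q∣≤∣p∣+∣q∣ (outside ∷ p) (inside  ∷ q) =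
  subst (suc ∣ p ∪ q ∣ ≤ℕ_) (sym (ℕₚ.+-suc ∣ p ∣ ∣ q ∣)) (s≤s (∣p∪q∣≤∣p∣+∣q∣ p q))
∣p∪q∣≤∣p∣+∣q∣ (inside  ∷ p) (inside  ∷ q) =
  s≤s (ℕₚ.≤-trans (∣p∪q∣≤∣p∣+∣q∣ p q) (ℕₚ.+-monoʳ-≤ ∣ p ∣ (ℕₚ.n≤1+n ∣ q ∣)))

∣p∩q∣+∣p∩∁q∣≡∣p∣ : ∀ {n} (p q : Subset n) → ∣ p ∩ q ∣ +ℕ ∣ p ∩ ∁ q ∣ ≡ ∣ p ∣
∣p∩q∣+∣p∩∁q∣≡∣p∣ []            []            = refl
∣p∩q∣+∣p∩∁q∣≡∣p∣ (outside ∷ p) (_       ∷ q) = ∣p∩q∣+∣p∩∁q∣≡∣p∣ p q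
∣p∩q∣+∣p∩∁q∣≡∣p∣ (inside  ∷ p) (inside  ∷ q) = cong suc (∣p∩q∣+∣p∩∁q∣≡∣p∣ p q)
∣p∩q∣+∣p∩∁q∣≡∣p∣ (inside  ∷ p) (outside ∷ q) =
  trans (ℕₚ.+-suc ∣ p ∩ q ∣ ∣ p ∩ ∁ q ∣) (cong suc (∣p∩q∣+∣p∩∁q∣≡∣p∣ p q))

p⊆[p∩q]∪[p∩∁q] : ∀ {n} (p q : Subset n) → p ⊆ (p ∩ q) ∪ (p ∩ ∁ q)
p⊆[p∩q]∪[p∩∁q] p q {x} x∈p with x ∈? q
... | yes x∈q = x∈p∪q⁺ (inj₁ (x∈p∩q⁺ (x∈p , x∈q)))
... | no  x∉q = x∈p∪q⁺ (inj₂ (x∈p∩q⁺ (x∈p , x∉p⇒x∈∁p x∉q)))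

∪-lub : ∀ {n} {p q r : Subset n} → p ⊆ r → q ⊆ r → p ∪ q ⊆ r
∪-lub {p = p} {q} p⊆r q⊆r x∈ = [ p⊆r , q⊆r ]′ (x∈p∪q⁻ p q x∈)

∪-mono : ∀ {n} {p p′ q q′ : Subset n} → p ⊆ p′ → q ⊆ q′ → p ∪ q ⊆ p′ ∪ q′
∪-mono {p′ = p′} {q′ = q′} p⊆ q⊆ = ∪-lub (p⊆p∪q q′ ∘ p⊆) (q⊆p∪q p′ q′ ∘ q⊆)

∪-swap⊆ : ∀ {n} (p q : Subset n) → p ∪ q ⊆ q ∪ p
∪-swap⊆ p q = ⊆-reflexive (∪-comm p q)

-- Bob reads a message as a set: order and repetitions carry no information, so the sets for all
-- guesses can be concatenated without separators.
fromList : ∀ {n} → List (Fin n) → Subset n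
fromList []       = ⊥
fromList (x ∷ xs) = ⁅ x ⁆ ∪ fromList xs

∈-fromList⁺ : ∀ {n} {x : Fin n} {xs} → x ∈ˡ xs → x ∈ fromList xs
∈-fromList⁺ {x = x} (here refl)  = x∈p∪q⁺ (inj₁ (x∈⁅x⁆ x))
∈-fromList⁺         (there x∈xs) = x∈p∪q⁺ (inj₂ (∈-fromList⁺ x∈xs))

∈-fromList⁻ : ∀ {n} {x : Fin n} xs → x ∈ fromList xs → x ∈ˡ xs
∈-fromList⁻ []       x∈ = contradiction x∈ ∉⊥
∈-fromList⁻ (y ∷ xs) x∈ with x∈p∪q⁻ ⁅ y ⁆ (fromList xs) x∈
... | inj₁ x∈⁅y⁆ = here (x∈⁅y⁆⇒x≡y y x∈⁅y⁆)
... | inj₂ x∈xs  = there (∈-fromList⁻ xs x∈xs)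

∣fromList∣≤length : ∀ {n} (xs : List (Fin n)) → ∣ fromList xs ∣ ≤ℕ length xs
∣fromList∣≤length {n} []       = ℕₚ.≤-reflexive (∣⊥∣≡0 n)
∣fromList∣≤length     (x ∷ xs) = begin
  ∣ ⁅ x ⁆ ∪ fromList xs ∣       ≤⟨ ∣p∪q∣≤∣p∣+∣q∣ ⁅ x ⁆ (fromList xs) ⟩
  ∣ ⁅ x ⁆ ∣ +ℕ ∣ fromList xs ∣  ≤⟨ ℕₚ.+-mono-≤ (ℕₚ.≤-reflexive (∣⁅x⁆∣≡1 x)) (∣fromList∣≤length xs) ⟩
  suc (length xs)               ∎
  where open ℕₚ.≤-Reasoning

elements : ∀ {n} → Subset n → List (Fin n)
elements []            = []
elements (inside  ∷ p) = zero ∷ map suc (elements p)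
elements (outside ∷ p) = map suc (elements p)

∈-elements⁺ : ∀ {n} {x : Fin n} {p} → x ∈ p → x ∈ˡ elements p
∈-elements⁺                     here        = here refl
∈-elements⁺ {p = inside  ∷ p} (there x∈p) = there (∈-map⁺ suc (∈-elements⁺ x∈p))
∈-elements⁺ {p = outside ∷ p} (there x∈p) = ∈-map⁺ suc (∈-elements⁺ x∈p)

∈-elements⁻ : ∀ {n} {x : Fin n} p → x ∈ˡ elements p → x ∈ p
∈-elements⁻ (inside  ∷ p) (here refl) = here
∈-elements⁻ (inside  ∷ p) (there x∈) with _ , y∈ , refl ← ∈-map⁻ suc x∈ = there (∈-elements⁻ p y∈)
∈-elements⁻ (outside ∷ p) x∈         with _ , y∈ , refl ← ∈-map⁻ suc x∈ = there (∈-elements⁻ p y∈)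

length-elements : ∀ {n} (p : Subset n) → length (elements p) ≡ ∣ p ∣
length-elements []            = refl
length-elements (inside  ∷ p) = cong suc (trans (length-map suc (elements p)) (length-elements p))
length-elements (outside ∷ p) = trans (length-map suc (elements p)) (length-elements p)

fromList∘elements⊆ : ∀ {n} (p : Subset n) → fromList (elements p) ⊆ p
fromList∘elements⊆ p = ∈-elements⁻ p ∘ ∈-fromList⁻ (elements p)

⊆fromList∘elements : ∀ {n} (p : Subset n) → p ⊆ fromList (elements p)
⊆fromList∘elements p = ∈-fromList⁺ ∘ ∈-elements⁺

subsets : ∀ n → List (Subset n)
subsets zero    = [] ∷ []
subsets (suc n) = map (inside ∷_) (subsets n) ++ map (outside ∷_) (subsets n)

∈-subsets : ∀ {n} (p : Subset n) → p ∈ˡ subsets n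
∈-subsets []            = here refl
∈-subsets (inside  ∷ p) = ∈-++⁺ˡ (∈-map⁺ (inside ∷_) (∈-subsets p))
∈-subsets (outside ∷ p) = ∈-++⁺ʳ _ (∈-map⁺ (outside ∷_) (∈-subsets p))

length-concatMap-≤ : ∀ {A B : Set} (f : A → List B) b xs →
                     All (λ x → length (f x) ≤ℕ b) xs →
                     length (concatMap f xs) ≤ℕ length xs *ℕ b
length-concatMap-≤ f b []       []         = z≤n
length-concatMap-≤ f b (x ∷ xs) (p ∷ ps) = begin
  length (f x ++ concatMap f xs)          ≡⟨ length-++ (f x) ⟩
  length (f x) +ℕ length (concatMap f xs) ≤⟨ ℕₚ.+-mono-≤ p (length-concatMap-≤ f b xs ps) ⟩
  b +ℕ length xs *ℕ b                     ∎
  where open ℕₚ.≤-Reasoning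

-- Ordered fields

module OrderedField (R : RealNumbers) where
  open RealNumbers R
  open CommutativeRing commutativeRing public
    using (+-comm; +-assoc; +-identityˡ; +-identityʳ; -‿inverseʳ; -‿inverseˡ;
           *-comm; *-assoc; *-identityˡ; *-identityʳ; zeroˡ; zeroʳ; distribʳ; distribˡ;
           semiring; ring; commutativeSemiring)
  open RingProperties ring using (-‿distribˡ-*; -‿involutive)
  open SemiringMult semiring using (×-homo-+; ×1-homo-*)

  totalOrder : TotalOrder _ _ _
  totalOrder = record
    { isTotalOrder = IsDecTotalOrder.isTotalOrder isDecTotalOrder }

  open TotalOrder totalOrder public
    using (poset; total; antisym) renaming (refl to ≤-refl; trans to ≤-trans; reflexive to ≤-reflexive)

  module ≤-Reasoning = PartialOrderReasoning poset
  open ≤-Reasoning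

  module Solver = SemiringSolver commutativeSemiring

  +-monoʳ-≤ : ∀ z {x y} → x ≤ y → z + x ≤ z + y
  +-monoʳ-≤ z {x} {y} x≤y = subst₂ _≤_ (+-comm x z) (+-comm y z) (+-monoˡ-≤ z x≤y)

  +-mono-≤ : ∀ {x y u v} → x ≤ y → u ≤ v → x + u ≤ y + v
  +-mono-≤ {y = y} {u} x≤y u≤v = ≤-trans (+-monoˡ-≤ u x≤y) (+-monoʳ-≤ y u≤v)

  x+z-z≡x : ∀ x z → x + z + (- z) ≡ x
  x+z-z≡x x z = trans (+-assoc x z (- z)) (trans (cong (x +_) (-‿inverseʳ z)) (+-identityʳ x))

  x-z+z≡x : ∀ x z → x - z + z ≡ x
  x-z+z≡x x z = trans (+-assoc x (- z) z) (trans (cong (x +_) (-‿inverseˡ z)) (+-identityʳ x))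

  +-cancelʳ-≤ : ∀ z {x y} → x + z ≤ y + z → x ≤ y
  +-cancelʳ-≤ z {x} {y} p = subst₂ _≤_ (x+z-z≡x x z) (x+z-z≡x y z) (+-monoˡ-≤ (- z) p)

  x≤y⇒0≤y-x : ∀ {x y} → x ≤ y → 0# ≤ y - x
  x≤y⇒0≤y-x {x} {y} x≤y = subst (_≤ y - x) (-‿inverseʳ x) (+-monoˡ-≤ (- x) x≤y)

  -- Turns diminishing returns into a form without subtraction. Submodularity is used only in that
  -- form, so the remaining rearrangements are identities of commutative semirings.
  a-b≤c-d⇒a+d≤b+c : ∀ {a b c d} → a - b ≤ c - d → a + d ≤ b + c
  a-b≤c-d⇒a+d≤b+c {a} {b} {c} {d} p = begin
    a + d               ≡⟨ cong (_+ d) (sym (x-z+z≡x a b)) ⟩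
    a - b + b + d       ≤⟨ +-monoˡ-≤ d (+-monoˡ-≤ b p) ⟩
    c - d + b + d       ≡⟨ solve 3 (λ x b d → x :+ b :+ d := b :+ (x :+ d)) refl (c - d) b d ⟩
    b + (c - d + d)     ≡⟨ cong (b +_) (x-z+z≡x c d) ⟩
    b + c               ∎
    where open Solver

  *-monoˡ-≤ : ∀ z {x y} → 0# ≤ z → x ≤ y → z * x ≤ z * y
  *-monoˡ-≤ z {x} {y} 0≤z x≤y = begin
    z * x                   ≡⟨ sym (+-identityˡ (z * x)) ⟩
    0# + z * x              ≤⟨ +-monoˡ-≤ (z * x) (*-nonNegative 0≤z (x≤y⇒0≤y-x x≤y)) ⟩
    z * (y - x) + z * x     ≡⟨ sym (distribˡ z (y - x) x) ⟩
    z * (y - x + x)         ≡⟨ cong (z *_) (x-z+z≡x y x) ⟩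
    z * y                   ∎

  *-monoʳ-≤ : ∀ z {x y} → 0# ≤ z → x ≤ y → x * z ≤ y * z
  *-monoʳ-≤ z {x} {y} 0≤z x≤y = subst₂ _≤_ (*-comm z x) (*-comm z y) (*-monoˡ-≤ z 0≤z x≤y)

  *-cancelˡ-≡ : ∀ z {x y} → 0# < z → z * x ≡ z * y → x ≡ y
  *-cancelˡ-≡ z {x} {y} (_ , 0≢z) eq = trans (sym (undo x)) (trans (cong (z ⁻¹ *_) eq) (undo y))
    where
    undo : ∀ w → z ⁻¹ * (z * w) ≡ w
    undo w = trans (sym (*-assoc (z ⁻¹) z w))
      (trans (cong (_* w) (trans (*-comm (z ⁻¹) z) (⁻¹-inverse (0≢z ∘ sym)))) (*-identityˡ w))

  -- By totality: if `y ≤ x`, monotonicity and antisymmetry make the two products equal, and an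
  -- equality cancels by the inverse. The sign of `z ⁻¹` never has to be determined.
  *-cancelˡ-≤ : ∀ z {x y} → 0# < z → z * x ≤ z * y → x ≤ y
  *-cancelˡ-≤ z {x} {y} 0<z p with total x y
  ... | inj₁ x≤y = x≤y
  ... | inj₂ y≤x = ≤-reflexive (*-cancelˡ-≡ z 0<z (antisym p (*-monoˡ-≤ z (proj₁ 0<z) y≤x)))

  -- Otherwise `- 1#` would be non-negative, and `1#` is its square.
  0≤1 : 0# ≤ 1#
  0≤1 with total 0# 1#
  ... | inj₁ 0≤1 = 0≤1
  ... | inj₂ 1≤0 = subst (0# ≤_) eq (*-nonNegative 0≤-1 0≤-1)
    where
    0≤-1 : 0# ≤ - 1#
    0≤-1 = subst (0# ≤_) (+-identityˡ (- 1#)) (x≤y⇒0≤y-x 1≤0)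
    eq : (- 1#) * (- 1#) ≡ 1#
    eq = trans (sym (-‿distribˡ-* 1# (- 1#)))
           (trans (cong -_ (*-identityˡ (- 1#))) (-‿involutive 1#))

  0≤ι : ∀ n → 0# ≤ ι n
  0≤ι zero    = ≤-refl
  0≤ι (suc n) = subst (_≤ ι (suc n)) (+-identityˡ 0#) (+-mono-≤ 0≤1 (0≤ι n))

  ι-mono-≤ : ∀ {m n} → m ≤ℕ n → ι m ≤ ι n
  ι-mono-≤ {n = n} z≤n = 0≤ι n
  ι-mono-≤ (s≤s m≤n)   = +-monoʳ-≤ 1# (ι-mono-≤ m≤n)

  ι1≡1 : ι 1 ≡ 1#
  ι1≡1 = +-identityʳ 1#

  0<ι : ∀ {n} → 0 ℕ.< n → 0# < ι n
  0<ι {n} 0<n = 0≤ι n , λ 0≡ι → 0≢1 (antisym 0≤1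
    (subst₂ _≤_ ι1≡1 (sym 0≡ι) (ι-mono-≤ 0<n)))

  ι-+ : ∀ m n → ι (m +ℕ n) ≡ ι m + ι n
  ι-+ = ×-homo-+ 1#

  x∙yz≈y∙xz : ∀ x y z → x * (y * z) ≡ y * (x * z)
  x∙yz≈y∙xz = solve 3 (λ x y z → x :* (y :* z) := y :* (x :* z)) refl
    where open Solver

  ι-* : ∀ m n → ι (m *ℕ n) ≡ ι m * ι n
  ι-* = ×1-homo-*

-- Monotone submodular functions

module SubmodularFunction (R : RealNumbers) {n : ℕ} (f : Subset n → RealNumbers.ℝ R)
  (nonNegative : TwoPlayer.NonNegative R f) (monotone : TwoPlayer.Monotone R f)
  (submodular : TwoPlayer.Submodular R f) where

  open RealNumbers R
  open OrderedField R
  open ≤-Reasoning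

  private
    mono : ∀ {X Y} → X ⊆ Y → f X ≤ f Y
    mono {X} {Y} = monotone X Y

  -- Removes the restriction `v ∉ Y`: when `v ∈ Y`, adding `v` leaves `Y` unchanged, and
  -- monotonicity gives `f X ≤ f (X ∪ ⁅ v ⁆)`.
  submodular-⁅⁆ : ∀ {X Y} v → X ⊆ Y → f (Y ∪ ⁅ v ⁆) + f X ≤ f Y + f (X ∪ ⁅ v ⁆)
  submodular-⁅⁆ {X} {Y} v X⊆Y with v ∈? Y
  ... | no  v∉Y = a-b≤c-d⇒a+d≤b+c (submodular X Y v X⊆Y v∉Y)
  ... | yes v∈Y = +-mono-≤ (mono (∪-lub id ⁅v⁆⊆Y)) (mono (p⊆p∪q ⁅ v ⁆))
    where
    ⁅v⁆⊆Y : ⁅ v ⁆ ⊆ Y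
    ⁅v⁆⊆Y x∈ = subst (_∈ Y) (sym (x∈⁅y⁆⇒x≡y v x∈)) v∈Y

  -- The elements are added one at a time. Summing the inequality for `v` and the one for the rest,
  -- based at `X ∪ ⁅ v ⁆`, the intermediate value `f (X ∪ ⁅ v ⁆)` occurs on both sides and cancels.
  submodular-fromList : ∀ {X Y} xs → X ⊆ Y →
    f (Y ∪ fromList xs) + f X ≤ f Y + f (X ∪ fromList xs)
  submodular-fromList {X} {Y} []       X⊆Y = +-mono-≤ (mono (∪-lub id ⊥⊆)) (mono (p⊆p∪q ⊥))
  submodular-fromList {X} {Y} (v ∷ xs) X⊆Y = +-cancelʳ-≤ (f (X ∪ ⁅ v ⁆)) (begin
    f (Y ∪ (⁅ v ⁆ ∪ L)) + f X + f (X ∪ ⁅ v ⁆)   ≤⟨ +-monoˡ-≤ _ (+-monoˡ-≤ _ (mono (⊆-reflexive (sym (∪-assoc Y ⁅ v ⁆ L))))) ⟩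
    f ((Y ∪ ⁅ v ⁆) ∪ L) + f X + f (X ∪ ⁅ v ⁆)     ≡⟨ solve 3 (λ a b c → a :+ b :+ c := a :+ c :+ b) refl (f ((Y ∪ ⁅ v ⁆) ∪ L)) (f X) (f (X ∪ ⁅ v ⁆)) ⟩
    f ((Y ∪ ⁅ v ⁆) ∪ L) + f (X ∪ ⁅ v ⁆) + f X     ≤⟨ +-monoˡ-≤ _ (submodular-fromList xs (∪-mono X⊆Y id)) ⟩
    f (Y ∪ ⁅ v ⁆) + f ((X ∪ ⁅ v ⁆) ∪ L) + f X     ≡⟨ solve 3 (λ a b c → a :+ b :+ c := a :+ c :+ b) refl (f (Y ∪ ⁅ v ⁆)) (f ((X ∪ ⁅ v ⁆) ∪ L)) (f X) ⟩
    f (Y ∪ ⁅ v ⁆) + f X + f ((X ∪ ⁅ v ⁆) ∪ L)     ≤⟨ +-mono-≤ (submodular-⁅⁆ v X⊆Y) (mono (⊆-reflexive (∪-assoc X ⁅ v ⁆ L))) ⟩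
    f Y + f (X ∪ ⁅ v ⁆) + f (X ∪ (⁅ v ⁆ ∪ L))   ≡⟨ solve 3 (λ a b c → a :+ b :+ c := a :+ c :+ b) refl (f Y) (f (X ∪ ⁅ v ⁆)) (f (X ∪ (⁅ v ⁆ ∪ L))) ⟩
    f Y + f (X ∪ (⁅ v ⁆ ∪ L)) + f (X ∪ ⁅ v ⁆)   ∎)
    where
    open Solver
    L = fromList xs

  submodular-∪ : ∀ {X Y} Z → X ⊆ Y → f (Y ∪ Z) + f X ≤ f Y + f (X ∪ Z)
  submodular-∪ {X} {Y} Z X⊆Y = begin
    f (Y ∪ Z) + f X                       ≤⟨ +-monoˡ-≤ _ (mono (∪-mono id (⊆fromList∘elements Z))) ⟩
    f (Y ∪ fromList (elements Z)) + f X   ≤⟨ submodular-fromList (elements Z) X⊆Y ⟩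
    f Y + f (X ∪ fromList (elements Z))   ≤⟨ +-monoʳ-≤ _ (mono (∪-mono id (fromList∘elements⊆ Z))) ⟩
    f Y + f (X ∪ Z)                       ∎

  -- The existential form of averaging over the removed element: the marginal
  -- losses f(Z ∪ X) - f(Z ∪ (X \ v)), summed over v ∈ X, are at most f(Z ∪ X) - f(Z).
  remove-cheapest : ∀ Z x xs → ∃ λ ys → length ys ≡ length xs × (∀ y → y ∈ˡ ys → y ∈ˡ x ∷ xs) ×
    ι (length xs) * f (Z ∪ fromList (x ∷ xs)) + f Z ≤ ι (suc (length xs)) * f (Z ∪ fromList ys)
  remove-cheapest Z x []        = [] , refl , (λ _ ()) , (begin
    -- `con 1 :+ con 0` spells out `ι 1`, which unfolds to `1# + 0#` and not to `1#`; larger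
    -- numerals are spelled out to the solver in the same way.
    0# * f (Z ∪ fromList (x ∷ [])) + f Z  ≡⟨ solve 2 (λ a b → con 0 :* a :+ b := (con 1 :+ con 0) :* b) refl _ (f Z) ⟩
    ι 1 * f Z                              ≤⟨ *-monoˡ-≤ (ι 1) (0≤ι 1) (mono (p⊆p∪q ⊥)) ⟩
    ι 1 * f (Z ∪ ⊥)                        ∎)
    where open Solver
  remove-cheapest Z x (x′ ∷ xs) with remove-cheapest (Z ∪ ⁅ x ⁆) x′ xs
  ... | ys , ∣ys∣ , ys⊆ , p =
    -- Two candidates: drop `x`, of value `β`, or keep `x` and drop what the recursive call over
    -- `Z ∪ ⁅ x ⁆` drops, of value at least `α`. The larger of `α` and `β` is at least their average
    -- with weights `m` and 1.
    [ (λ α≤β → x′ ∷ xs , refl , (λ _ y∈ → there y∈) , collect β α≤β ≤-refl)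
    , (λ β≤α → x ∷ ys , cong suc ∣ys∣ ,
        (λ { y (here eq) → here eq ; y (there y∈) → there (ys⊆ y y∈) }) ,
        collect (f (Z ∪ fromList (x ∷ ys))) α≤ (≤-trans β≤α α≤))
    ]′ (total α β)
    where
    open Solver
    L = fromList (x′ ∷ xs)
    m = ι (suc (length xs))
    F = f (Z ∪ fromList (x ∷ x′ ∷ xs))
    F₀ = f ((Z ∪ ⁅ x ⁆) ∪ L)
    α = f ((Z ∪ ⁅ x ⁆) ∪ fromList ys)
    β = f (Z ∪ L)

    α≤ : α ≤ f (Z ∪ fromList (x ∷ ys))
    α≤ = mono (⊆-reflexive (∪-assoc Z ⁅ x ⁆ (fromList ys)))

    -- The recursive inequality is added to submodularity for adding `L` to `Z` and to `Z ∪ ⁅ x ⁆`;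
    -- the common term `f (Z ∪ ⁅ x ⁆)` cancels.
    average : m * F + f Z ≤ m * α + β
    average = +-cancelʳ-≤ (f (Z ∪ ⁅ x ⁆)) (begin
      m * F + f Z + f (Z ∪ ⁅ x ⁆)
        ≤⟨ +-monoˡ-≤ _ (+-monoˡ-≤ _ (*-monoˡ-≤ m (0≤ι (suc (length xs)))
             (mono (⊆-reflexive (sym (∪-assoc Z ⁅ x ⁆ L)))))) ⟩
      m * F₀ + f Z + f (Z ∪ ⁅ x ⁆)
        ≡⟨ solve 4 (λ l F z a → (con 1 :+ l) :* F :+ z :+ a := (l :* F :+ a) :+ (F :+ z))
             refl (ι (length xs)) F₀ (f Z) (f (Z ∪ ⁅ x ⁆)) ⟩
      (ι (length xs) * F₀ + f (Z ∪ ⁅ x ⁆)) + (F₀ + f Z)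
        ≤⟨ +-mono-≤ p (submodular-∪ L (p⊆p∪q ⁅ x ⁆)) ⟩
      m * α + (f (Z ∪ ⁅ x ⁆) + β)
        ≡⟨ solve 3 (λ a b c → a :+ (b :+ c) := a :+ c :+ b) refl (m * α) (f (Z ∪ ⁅ x ⁆)) β ⟩
      m * α + β + f (Z ∪ ⁅ x ⁆)
        ∎)

    collect : ∀ γ → α ≤ γ → β ≤ γ → m * F + f Z ≤ ι (suc (suc (length xs))) * γ
    collect γ α≤γ β≤γ = begin
      m * F + f Z   ≤⟨ average ⟩
      m * α + β     ≤⟨ +-mono-≤ (*-monoˡ-≤ m (0≤ι (suc (length xs))) α≤γ) β≤γ ⟩
      m * γ + γ     ≡⟨ solve 2 (λ m γ → m :* γ :+ γ := (con 1 :+ m) :* γ) refl m γ ⟩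
      (1# + m) * γ  ∎

  -- Removing the cheapest element of `s + 1` keeps a fraction `s / (s + 1)` of the value, and these
  -- fractions telescope to `t / s`. The induction runs on a bound `s` for the length, since the
  -- list may be shorter than the budget that is being rounded.
  trim-list : ∀ Z s t xs → length xs ≤ℕ s → t ≤ℕ s → ∃ λ ys →
    length ys ≤ℕ t × (∀ y → y ∈ˡ ys → y ∈ˡ xs) ×
    ι t * f (Z ∪ fromList xs) ≤ ι s * f (Z ∪ fromList ys)
  trim-list Z s zero xs _ _ =
    [] , z≤n , (λ _ ()) ,
    subst (_≤ ι s * f (Z ∪ ⊥)) (sym (zeroˡ (f (Z ∪ fromList xs))))
      (*-nonNegative (0≤ι s) (nonNegative (Z ∪ ⊥)))
  trim-list Z (suc s) (suc t) xs ∣xs∣≤ t≤s with ℕₚ.m≤n⇒m<n∨m≡n t≤s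
  trim-list Z (suc s) (suc t) xs ∣xs∣≤ t≤s | inj₂ refl = xs , ∣xs∣≤ , (λ _ → id) , ≤-refl
  trim-list Z (suc s) (suc t) xs ∣xs∣≤ t≤s | inj₁ (s≤s t<s) with ℕₚ.m≤n⇒m<n∨m≡n ∣xs∣≤
  -- The list already fits the smaller bound, so nothing is removed; raising the factor from `ι s`
  -- to `ι (suc s)` only weakens the inequality.
  ... | inj₁ (s≤s ∣xs∣≤s) =
    let ys , ∣ys∣≤ , ys⊆ , p = trim-list Z s (suc t) xs ∣xs∣≤s t<s
    in ys , ∣ys∣≤ , ys⊆ ,
       ≤-trans p (*-monoʳ-≤ _ (nonNegative _) (ι-mono-≤ (ℕₚ.n≤1+n s)))
  trim-list Z (suc s) (suc t) (x ∷ xs) ∣xs∣≤ t≤s | inj₁ (s≤s t<s) | inj₂ ∣xs∣≡s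
    with zs , ∣zs∣ , zs⊆ , p ← remove-cheapest Z x xs
    rewrite ℕₚ.suc-injective ∣xs∣≡s
    with ys , ∣ys∣≤ , ys⊆ , q ← trim-list Z s (suc t) zs (ℕₚ.≤-reflexive ∣zs∣) t<s
    = ys , ∣ys∣≤ , (λ y → zs⊆ y ∘ ys⊆ y) ,
      -- Multiplying by `ι s` lets the removal step and the recursive call be chained without
      -- division; `s` is positive because `suc t ≤ s`.
      *-cancelˡ-≤ (ι s) (0<ι (ℕₚ.≤-trans (s≤s z≤n) t<s)) (begin
        ι s * (ι (suc t) * F)        ≡⟨ x∙yz≈y∙xz (ι s) (ι (suc t)) F ⟩
        ι (suc t) * (ι s * F)        ≤⟨ *-monoˡ-≤ (ι (suc t)) (0≤ι (suc t)) sF≤ ⟩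
        ι (suc t) * (ι (suc s) * G)  ≡⟨ x∙yz≈y∙xz (ι (suc t)) (ι (suc s)) G ⟩
        ι (suc s) * (ι (suc t) * G)  ≤⟨ *-monoˡ-≤ (ι (suc s)) (0≤ι (suc s)) q ⟩
        ι (suc s) * (ι s * H)        ≡⟨ x∙yz≈y∙xz (ι (suc s)) (ι s) H ⟩
        ι s * (ι (suc s) * H)        ∎)
    where
    F = f (Z ∪ fromList (x ∷ xs))
    G = f (Z ∪ fromList zs)
    H = f (Z ∪ fromList ys)

    sF≤ : ι s * F ≤ ι (suc s) * G
    sF≤ = begin
      ι s * F        ≡⟨ sym (+-identityʳ (ι s * F)) ⟩
      ι s * F + 0#   ≤⟨ +-monoʳ-≤ (ι s * F) (nonNegative Z) ⟩
      ι s * F + f Z  ≤⟨ p ⟩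
      ι (suc s) * G  ∎

  trim : ∀ X Z {s t} → ∣ X ∣ ≤ℕ s → t ≤ℕ s → ∃ λ X′ →
    X′ ⊆ X × ∣ X′ ∣ ≤ℕ t × ι t * f (Z ∪ X) ≤ ι s * f (Z ∪ X′)
  trim X Z {s} {t} ∣X∣≤s t≤s =
    let ys , ∣ys∣≤t , ys⊆ , p = trim-list Z s t (elements X)
          (subst (_≤ℕ s) (sym (length-elements X)) ∣X∣≤s) t≤s
    in fromList ys
     , (λ {y} → ∈-elements⁻ X ∘ ys⊆ y ∘ ∈-fromList⁻ ys)
     , ℕₚ.≤-trans (∣fromList∣≤length ys) ∣ys∣≤t
     , ≤-trans (*-monoˡ-≤ (ι t) (0≤ι t) (mono (∪-mono id (⊆fromList∘elements X)))) p

  -- The kept fraction is at least `t / s ≥ 1 - d / s`, and `s ≥ k / 2` bounds the loss by a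
  -- fraction `2d / k`. The statement is this estimate with denominators cleared.
  trim-loss : ∀ X Z {k s t d} → ∣ X ∣ ≤ℕ s → t ≤ℕ s → k ≤ℕ s +ℕ s → s ≤ℕ d +ℕ t → ∃ λ X′ →
    X′ ⊆ X × ∣ X′ ∣ ≤ℕ t × ι k * f (Z ∪ X) ≤ ι k * f (Z ∪ X′) + (ι d + ι d) * f (Z ∪ X)
  trim-loss X Z {k} {s} {t} {d} ∣X∣≤s t≤s k≤2s s≤d+t
    with X′ , X′⊆X , ∣X′∣≤t , p ← trim X Z ∣X∣≤s t≤s
    = X′ , X′⊆X , ∣X′∣≤t , +-cancelʳ-≤ (ι e * F) (begin
      ι k * F + ι e * F                                   ≡⟨ split F ⟩
      ι s * F + ι s * F                                   ≤⟨ +-mono-≤ sF≤ sF≤ ⟩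
      (ι d * F + ι s * G) + (ι d * F + ι s * G)           ≡⟨ solve 3 (λ a F b → (a :* F :+ b) :+ (a :* F :+ b) := (b :+ b) :+ (a :+ a) :* F) refl (ι d) F (ι s * G) ⟩
      (ι s * G + ι s * G) + (ι d + ι d) * F               ≡⟨ cong (_+ (ι d + ι d) * F) (sym (split G)) ⟩
      (ι k * G + ι e * G) + (ι d + ι d) * F               ≤⟨ +-monoˡ-≤ _ (+-monoʳ-≤ _ (*-monoˡ-≤ (ι e) (0≤ι e) (mono (∪-mono id X′⊆X)))) ⟩
      (ι k * G + ι e * F) + (ι d + ι d) * F               ≡⟨ solve 3 (λ a b c → (a :+ b) :+ c := (a :+ c) :+ b) refl (ι k * G) (ι e * F) ((ι d + ι d) * F) ⟩
      ι k * G + (ι d + ι d) * F + ι e * F                 ∎)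
    where
    open Solver
    -- The surplus of `2s` over `k`. Doubling `sF≤` gives `k + e` copies of `F` and of `G`; the `e`
    -- extra ones are removed by `G ≤ F`.
    e = (s +ℕ s) ∸ k
    F = f (Z ∪ X)
    G = f (Z ∪ X′)

    split : ∀ x → ι k * x + ι e * x ≡ ι s * x + ι s * x
    split x = trans (sym (distribʳ x (ι k) (ι e)))
      (trans (cong (_* x) (trans (sym (ι-+ k e)) (trans (cong ι (ℕₚ.m+[n∸m]≡n k≤2s)) (ι-+ s s))))
             (distribʳ x (ι s) (ι s)))

    sF≤ : ι s * F ≤ ι d * F + ι s * G
    sF≤ = begin
      ι s * F             ≤⟨ *-monoʳ-≤ F (nonNegative _) (ι-mono-≤ s≤d+t) ⟩
      ι (d +ℕ t) * F      ≡⟨ trans (cong (_* F) (ι-+ d t)) (distribʳ F (ι d) (ι t)) ⟩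
      ι d * F + ι t * F   ≤⟨ +-monoʳ-≤ (ι d * F) p ⟩
      ι d * F + ι s * G   ∎

-- The protocol

module SketchProtocol (R : RealNumbers) where
  open RealNumbers R
  open TwoPlayer R
  open OrderedField R
  open Extrema totalOrder using (argmax; argmax-all; f[xs]≤f[argmax])
  open ≤-Reasoning

  dirac : {A : Set} → A → Distribution A
  dirac x = record
    { weighted   = (1# , x) ∷ []
    ; positive   = (0≤1 , 0≢1) ∷ []
    ; normalised = +-identityʳ 1#
    }

  𝔼-dirac : {A : Set} (x : A) (g : A → ℝ) → 𝔼 (dirac x) g ≡ g x
  𝔼-dirac x g = trans (+-identityʳ (1# * g x)) (*-identityˡ (g x))

  abstract
    -- Exhaustive search, as computation time is unrestricted. The default value `⊥` takes part in
    -- the maximum, whence the assumption `P ⊥` in `best-satisfies`.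
    best : ∀ {n} {P : Subset n → Set} → Decidable P → (Subset n → ℝ) → Subset n
    best {n} P? g = argmax g ⊥ (filter P? (subsets n))

    best-satisfies : ∀ {n} {P : Subset n → Set} (P? : Decidable P) (g : Subset n → ℝ) → P ⊥ → P (best P? g)
    best-satisfies {n} {P} P? g P⊥ =
      argmax-all g {P = P} P⊥ (All.tabulate (proj₂ ∘ ∈-filter⁻ P? {xs = subsets n}))

    best-maximal : ∀ {n} {P : Subset n → Set} (P? : Decidable P) (g : Subset n → ℝ) X → P X → g X ≤ g (best P? g)
    best-maximal {n} P? g X PX =
      All.lookup (f[xs]≤f[argmax] {f = g} ⊥ (filter P? (subsets n))) (∈-filter⁺ P? (∈-subsets X) PX)

  ∣⊥∣≤ : ∀ n i → ∣ ⊥ {n} ∣ ≤ℕ i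
  ∣⊥∣≤ n i = subst (_≤ℕ i) (sym (∣⊥∣≡0 n)) z≤n

  module Alice (G : Global) (V-A : Subset (Global.n G)) (V-A⊆W-A : V-A ⊆ Global.W-A G)
               (oracle : Global.OracleA G) where
    open Global G

    -- Intersecting with `V-A` makes every query legal, so Alice can search over all subsets of the
    -- ground set and cut the winner back to `V-A` afterwards without changing its value.
    value : Subset n → ℝ
    value X = oracle (X ∩ V-A) (λ x∈ → V-A⊆W-A (p∩q⊆q X V-A x∈))

    bounded? : ∀ i → Decidable (λ (X : Subset n) → ∣ X ∣ ≤ℕ i)
    bounded? i X = ∣ X ∣ ℕ.≤? i

    X₁ X₂ M₁ M₂ : ℕ → Subset n
    X₁ i = best (bounded? i) value
    M₁ i = X₁ i ∩ V-A
    X₂ i = best (bounded? i) (λ X → value (M₁ i ∪ X))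
    M₂ i = X₂ i ∩ V-A

    ∣M₁∣≤ : ∀ i → ∣ M₁ i ∣ ≤ℕ i
    ∣M₁∣≤ i = ℕₚ.≤-trans (∣p∩q∣≤∣p∣ (X₁ i) V-A) (best-satisfies (bounded? i) value (∣⊥∣≤ n i))

    ∣M₂∣≤ : ∀ i → ∣ M₂ i ∣ ≤ℕ i
    ∣M₂∣≤ i = ℕₚ.≤-trans (∣p∩q∣≤∣p∣ (X₂ i) V-A)
      (best-satisfies (bounded? i) (λ X → value (M₁ i ∪ X)) (∣⊥∣≤ n i))

    sketch : ℕ → Message
    sketch i = elements (M₁ i) ++ elements (M₂ i)

    sketches : List ℕ → Message
    sketches = concatMap sketch

    ∈-sketch⁻ : ∀ {x} i → x ∈ˡ sketch i → x ∈ V-A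
    ∈-sketch⁻ i x∈ with ∈-++⁻ (elements (M₁ i)) x∈
    ... | inj₁ x∈₁ = p∩q⊆q (X₁ i) V-A (∈-elements⁻ (M₁ i) x∈₁)
    ... | inj₂ x∈₂ = p∩q⊆q (X₂ i) V-A (∈-elements⁻ (M₂ i) x∈₂)

    sketches⊆V-A : ∀ sizes → fromList (sketches sizes) ⊆ V-A
    sketches⊆V-A sizes x∈ =
      let i , x∈i = satisfied (∈-concatMap⁻ sketch {xs = sizes} (∈-fromList⁻ (sketches sizes) x∈))
      in ∈-sketch⁻ i x∈i

    M₁⊆sketches : ∀ {i sizes} → i ∈ˡ sizes → M₁ i ⊆ fromList (sketches sizes)
    M₁⊆sketches i∈ x∈ =
      ∈-fromList⁺ (∈-concatMap⁺ sketch (lose i∈ (∈-++⁺ˡ (∈-elements⁺ x∈))))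

    M₂⊆sketches : ∀ {i sizes} → i ∈ˡ sizes → M₂ i ⊆ fromList (sketches sizes)
    M₂⊆sketches {i} i∈ x∈ =
      ∈-fromList⁺ (∈-concatMap⁺ sketch (lose i∈ (∈-++⁺ʳ (elements (M₁ i)) (∈-elements⁺ x∈))))

    length-sketch : ∀ i → length (sketch i) ≤ℕ i +ℕ i
    length-sketch i = subst (_≤ℕ i +ℕ i)
      (sym (trans (length-++ (elements (M₁ i)))
                  (cong₂ _+ℕ_ (length-elements (M₁ i)) (length-elements (M₂ i)))))
      (ℕₚ.+-mono-≤ (∣M₁∣≤ i) (∣M₂∣≤ i))

    length-sketches : ∀ sizes → All (_≤ℕ k) sizes →
                      length (sketches sizes) ≤ℕ length sizes *ℕ (k +ℕ k)
    length-sketches sizes sizes≤k = length-concatMap-≤ sketch (k +ℕ k) sizes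
      (All.map (λ {i} i≤k → ℕₚ.≤-trans (length-sketch i) (ℕₚ.+-mono-≤ i≤k i≤k)) sizes≤k)

  module Bob (G : Global) (V-B : Subset (Global.n G)) (oracle : Global.OracleB G)
             (m : Global.Message G) where
    open Global G

    Candidate : Subset n → Set
    Candidate S = S ⊆ fromList m ∪ V-B × ∣ S ∣ ≤ℕ k

    candidate? : Decidable Candidate
    candidate? S = S ⊆? (fromList m ∪ V-B) ×-dec ∣ S ∣ ℕ.≤? k

    answer : Subset n
    answer = best candidate? oracle

    answer-candidate : Candidate answer
    answer-candidate = best-satisfies candidate? oracle ((λ x∈ → ⊥⊆ x∈) , ∣⊥∣≤ n k)

    answer-maximal : ∀ S → Candidate S → oracle S ≤ oracle answer
    answer-maximal = best-maximal candidate? oracle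

  alice : (ℕ → List ℕ) → AliceAlgorithm
  alice sizes G V-A V-A⊆W-A oracle = dirac (Alice.sketches G V-A V-A⊆W-A oracle (sizes (Global.k G)))

  bob : BobAlgorithm
  bob G V-B _ oracle m = dirac (Bob.answer G V-B oracle m)

  feasible : ∀ sizes G (I : Instance G) m S → let open Instance I in
    m ∈supp alice sizes G V-A V-A⊆W-A oracleA → S ∈supp bob G V-B V-B⊆W-B oracleB m → Feasible S
  feasible sizes G I m S (here refl) (here refl) =
    (λ x∈ → ∪-mono (λ y∈ → sketches⊆V-A (sizes k) y∈) id (proj₁ answer-candidate x∈)) ,
    proj₂ answer-candidate
    where
    open Global G
    open Instance I
    open Alice G V-A V-A⊆W-A oracleA
    open Bob G V-B oracleB (sketches (sizes k))

  protocol : (ℕ → List ℕ) → Protocol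
  protocol sizes = record { alice = alice sizes ; bob = bob ; feasible = feasible sizes }

  communication : ∀ sizes (b : ℕ → ℝ) → (∀ k → All (_≤ℕ k) (sizes k)) →
    (∀ k → 0 ℕ.< k → ι (length (sizes k) *ℕ (k +ℕ k)) ≤ b k) → HasCommunicationAtMost (protocol sizes) b
  communication sizes b sizes≤ bound G I m (here refl) =
    ≤-trans (ι-mono-≤ (Alice.length-sketches G V-A V-A⊆W-A oracleA (sizes k) (sizes≤ k))) (bound k k>0)
    where
    open Global G
    open Instance I

  -- The two-thirds inequality for a suitable guess

  module Analysis (sizes : ℕ → List ℕ) (G : Global) (I : Instance G) where
    open Global G
    open Instance I
    open Alice G V-A V-A⊆W-A oracleA
    open Bob G V-B oracleB (sketches (sizes k))
    open SubmodularFunction R f nonNegative monotone submodular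

    v : ℝ
    v = f answer

    expectedValue≡v : Protocol.expectedValue (protocol sizes) G I ≡ v
    expectedValue≡v = trans (𝔼-dirac (sketches (sizes k)) (λ m → 𝔼 (bob G V-B V-B⊆W-B oracleB m) f))
                            (𝔼-dirac answer f)

    mono : ∀ {X Y} → X ⊆ Y → f X ≤ f Y
    mono {X} {Y} = monotone X Y

    M₁-maximal : ∀ {i X} → X ⊆ V-A → ∣ X ∣ ≤ℕ i → f X ≤ f (M₁ i)
    M₁-maximal {i} {X} X⊆ ∣X∣≤i = begin
      f X          ≤⟨ mono (λ x∈ → x∈p∩q⁺ (x∈ , X⊆ x∈)) ⟩
      f (X ∩ V-A)  ≤⟨ best-maximal (bounded? i) value X ∣X∣≤i ⟩
      f (M₁ i)     ∎

    M₂-maximal : ∀ {i X} → X ⊆ V-A → ∣ X ∣ ≤ℕ i → f (M₁ i ∪ X) ≤ f (M₁ i ∪ M₂ i)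
    M₂-maximal {i} {X} X⊆ ∣X∣≤i = begin
      f (M₁ i ∪ X)            ≤⟨ mono (λ x∈ → x∈p∩q⁺ (x∈ , ∪-lub (λ y∈ → p∩q⊆q (X₁ i) V-A y∈) X⊆ x∈)) ⟩
      f ((M₁ i ∪ X) ∩ V-A)    ≤⟨ best-maximal (bounded? i) (λ Y → value (M₁ i ∪ Y)) X ∣X∣≤i ⟩
      f ((M₁ i ∪ X₂ i) ∩ V-A) ≤⟨ mono restrict ⟩
      f (M₁ i ∪ M₂ i)         ∎
      where
      restrict : (M₁ i ∪ X₂ i) ∩ V-A ⊆ M₁ i ∪ M₂ i
      restrict x∈ with x∈∪ , x∈V ← x∈p∩q⁻ (M₁ i ∪ X₂ i) V-A x∈ with x∈p∪q⁻ (M₁ i) (X₂ i) x∈∪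
      ... | inj₁ x∈M₁ = x∈p∪q⁺ (inj₁ x∈M₁)
      ... | inj₂ x∈X₂ = x∈p∪q⁺ (inj₂ (x∈p∩q⁺ (x∈X₂ , x∈V)))

    -- Such a union is among the sets Bob compares: it lies within what he knows, and the two
    -- budgets add up to `k`.
    f≤v : ∀ {i M Y} → i ≤ℕ k → M ⊆ fromList (sketches (sizes k)) → Y ⊆ V-B →
          ∣ M ∣ ≤ℕ i → ∣ Y ∣ ≤ℕ k ∸ i → f (M ∪ Y) ≤ v
    f≤v {i} {M} {Y} i≤k M⊆ Y⊆ ∣M∣≤ ∣Y∣≤ = answer-maximal (M ∪ Y)
      ( (λ x∈ → ∪-mono M⊆ Y⊆ x∈)
      , ℕₚ.≤-trans (∣p∪q∣≤∣p∣+∣q∣ M Y)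
          (ℕₚ.≤-trans (ℕₚ.+-mono-≤ ∣M∣≤ ∣Y∣≤) (ℕₚ.≤-reflexive (ℕₚ.m+[n∸m]≡n i≤k))))

    -- With p = f(M₁ ∪ Y), q = f(M₂ ∪ Y), submodularity gives
    -- f(X ∪ Y) + f(M₁) ≤ p + f(M₁ ∪ X) and f(M₁ ∪ M₂) + f(Y) ≤ p + q,
    -- while f(M₁ ∪ X) ≤ f(M₁ ∪ M₂) and f(X ∪ Y) ≤ f(M₁) + f(Y).
    2f≤3v : ∀ {i X Y} → i ∈ˡ sizes k → i ≤ℕ k → X ⊆ V-A → Y ⊆ V-B → ∣ X ∣ ≤ℕ i → ∣ Y ∣ ≤ℕ k ∸ i →
            f (X ∪ Y) + f (X ∪ Y) ≤ v + (v + v)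
    2f≤3v {i} {X} {Y} i∈ i≤k X⊆ Y⊆ ∣X∣≤ ∣Y∣≤ = +-cancelʳ-≤ (a + c) (begin
      (F + F) + (a + c)             ≡⟨ solve 3 (λ F a c → (F :+ F) :+ (a :+ c) := F :+ ((F :+ a) :+ c)) refl F a c ⟩
      F + ((F + a) + c)             ≤⟨ +-mono-≤ F≤a+y (+-monoˡ-≤ c F+a≤v+c) ⟩
      (a + y) + ((v + c) + c)       ≡⟨ solve 4 (λ a y v c → (a :+ y) :+ ((v :+ c) :+ c) := (v :+ (c :+ y)) :+ (a :+ c)) refl a y v c ⟩
      (v + (c + y)) + (a + c)       ≤⟨ +-monoˡ-≤ (a + c) (+-monoʳ-≤ v c+y≤v+v) ⟩
      (v + (v + v)) + (a + c)       ∎)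
      where
      open Solver
      F = f (X ∪ Y)
      a = f (M₁ i)
      c = f (M₁ i ∪ X)
      y = f Y

      M₁∪Y≤v : f (M₁ i ∪ Y) ≤ v
      M₁∪Y≤v = f≤v i≤k (λ x∈ → M₁⊆sketches i∈ x∈) Y⊆ (∣M₁∣≤ i) ∣Y∣≤

      M₂∪Y≤v : f (M₂ i ∪ Y) ≤ v
      M₂∪Y≤v = f≤v i≤k (λ x∈ → M₂⊆sketches i∈ x∈) Y⊆ (∣M₂∣≤ i) ∣Y∣≤

      F≤a+y : F ≤ a + y
      F≤a+y = begin
        F                ≡⟨ sym (+-identityʳ F) ⟩
        F + 0#           ≤⟨ +-monoʳ-≤ F (nonNegative ⊥) ⟩
        F + f ⊥          ≤⟨ submodular-∪ Y ⊥⊆ ⟩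
        f X + f (⊥ ∪ Y)  ≤⟨ +-mono-≤ (M₁-maximal X⊆ ∣X∣≤) (mono (∪-lub ⊥⊆ id)) ⟩
        a + y            ∎

      F+a≤v+c : F + a ≤ v + c
      F+a≤v+c = begin
        F + a                   ≤⟨ +-monoˡ-≤ a (mono (∪-lub (q⊆p∪q (M₁ i ∪ Y) X)
                                     (λ x∈ → p⊆p∪q X (q⊆p∪q (M₁ i) Y x∈)))) ⟩
        f ((M₁ i ∪ Y) ∪ X) + a  ≤⟨ submodular-∪ X (p⊆p∪q Y) ⟩
        f (M₁ i ∪ Y) + c        ≤⟨ +-monoˡ-≤ c M₁∪Y≤v ⟩
        v + c                   ∎

      c+y≤v+v : c + y ≤ v + v
      c+y≤v+v = begin
        c + y                             ≤⟨ +-monoˡ-≤ y (M₂-maximal X⊆ ∣X∣≤) ⟩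
        f (M₁ i ∪ M₂ i) + y               ≤⟨ +-monoˡ-≤ y (mono (∪-mono (p⊆p∪q Y) id)) ⟩
        f ((M₁ i ∪ Y) ∪ M₂ i) + y         ≤⟨ submodular-∪ (M₂ i) (q⊆p∪q (M₁ i) Y) ⟩
        f (M₁ i ∪ Y) + f (Y ∪ M₂ i)       ≤⟨ +-mono-≤ M₁∪Y≤v (≤-trans (mono (∪-swap⊆ Y (M₂ i))) M₂∪Y≤v) ⟩
        v + v                             ∎

-- Rounding the size of Alice's part of the optimum

-- The spacing is `suc d`, hence positive, and `d` is the largest possible rounding loss. For
-- `d = 0` all of 0, ..., `k` are listed.
multiples : ℕ → ℕ → List ℕ
multiples d k = map (_*ℕ suc d) (upTo (suc (k /ℕ suc d)))

multiples≤ : ∀ d k → All (_≤ℕ k) (multiples d k)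
multiples≤ d k = map⁺ (All.tabulate λ {j} j∈ →
  ℕₚ.≤-trans (ℕₚ.*-monoˡ-≤ (suc d) (ℕ.s≤s⁻¹ (∈-upTo⁻ j∈))) (m/n*n≤m k (suc d)))

length-multiples : ∀ d k → length (multiples d k) ≡ suc (k /ℕ suc d)
length-multiples d k = trans (length-map (_*ℕ suc d) (upTo (suc (k /ℕ suc d)))) (length-upTo (suc (k /ℕ suc d)))

abstract
  roundDown : ℕ → ℕ → ℕ
  roundDown d s = s /ℕ suc d *ℕ suc d

  roundDown≤ : ∀ d s → roundDown d s ≤ℕ s
  roundDown≤ d s = m/n*n≤m s (suc d)

  ≤d+roundDown : ∀ d s → s ≤ℕ d +ℕ roundDown d s
  ≤d+roundDown d s = begin
    s                           ≡⟨ m≡m%n+[m/n]*n s (suc d) ⟩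
    s % suc d +ℕ roundDown d s  ≤⟨ ℕₚ.+-monoˡ-≤ (roundDown d s) (ℕ.s≤s⁻¹ (m%n<n s (suc d))) ⟩
    d +ℕ roundDown d s          ∎
    where open ℕₚ.≤-Reasoning

  -- The reflected half serves the case in which Bob's budget is rounded down to a multiple `t`, so
  -- that Alice's budget is `k ∸ t`.
  grid : ℕ → ℕ → List ℕ
  grid d k = multiples d k ++ map (k ∸_) (multiples d k)

  roundDown∈multiples : ∀ d {s k} → s ≤ℕ k → roundDown d s ∈ˡ multiples d k
  roundDown∈multiples d s≤k = ∈-map⁺ (_*ℕ suc d) (∈-upTo⁺ (s≤s (/-monoˡ-≤ (suc d) s≤k)))

  roundDown∈grid : ∀ d {s k} → s ≤ℕ k → roundDown d s ∈ˡ grid d k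
  roundDown∈grid d s≤k = ∈-++⁺ˡ (roundDown∈multiples d s≤k)

  k∸roundDown∈grid : ∀ d {s k} → s ≤ℕ k → k ∸ roundDown d s ∈ˡ grid d k
  k∸roundDown∈grid d {k = k} s≤k = ∈-++⁺ʳ (multiples d k) (∈-map⁺ (k ∸_) (roundDown∈multiples d s≤k))

  grid≤ : ∀ d k → All (_≤ℕ k) (grid d k)
  grid≤ d k = ++⁺ (multiples≤ d k) (map⁺ (All.map (λ {j} _ → ℕₚ.m∸n≤m k j) (multiples≤ d k)))

  length-grid : ∀ d k → length (grid d k) ≡ suc (k /ℕ suc d) +ℕ suc (k /ℕ suc d)
  length-grid d k = trans (length-++ (multiples d k))
    (cong₂ _+ℕ_ (length-multiples d k) (trans (length-map (k ∸_) (multiples d k)) (length-multiples d k)))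

-- Approximation guarantees and communication bounds

module Guarantees (R : RealNumbers) where
  open RealNumbers R
  open TwoPlayer R
  open OrderedField R
  open SketchProtocol R
  open ≤-Reasoning

  module _ (d : ℕ → ℕ) (G : Global) (I : Instance G) where
    open Global G
    open Instance I
    open Analysis (λ k → grid (d k) k) G I public using (v; expectedValue≡v; 2f≤3v)
    open SubmodularFunction R f nonNegative monotone submodular using (trim-loss)

    private
      δ = ι (d k)

    -- If |X| < k / 2, it is the budget k - |X| ≥ |Y| of Y, rather than |Y| itself,
    -- that is rounded down: |X| + |Y| may be much smaller than k.
    split-approximation : ∀ X Y → X ⊆ V-A → Y ⊆ V-B → ∣ X ∣ +ℕ ∣ Y ∣ ≤ℕ k →
      ∃ λ g → ι k * f (X ∪ Y) ≤ ι k * g + (δ + δ) * f (X ∪ Y) × g + g ≤ v + (v + v)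
    split-approximation X Y X⊆ Y⊆ ∣X∣+∣Y∣≤k = [ trim-X , trim-Y ]′ (ℕₚ.≤-total k (∣ X ∣ +ℕ ∣ X ∣))
      where
      Approximated : ℝ → Set
      Approximated g = ι k * f (X ∪ Y) ≤ ι k * g + (δ + δ) * f (X ∪ Y) × g + g ≤ v + (v + v)

      ∣Y∣≤k∸∣X∣ : ∣ Y ∣ ≤ℕ k ∸ ∣ X ∣
      ∣Y∣≤k∸∣X∣ = ℕₚ.m+n≤o⇒m≤o∸n ∣ Y ∣ (subst (_≤ℕ k) (ℕₚ.+-comm ∣ X ∣ ∣ Y ∣) ∣X∣+∣Y∣≤k)

      trim-X : k ≤ℕ ∣ X ∣ +ℕ ∣ X ∣ → ∃ Approximated
      trim-X k≤2a =
        let a  = ∣ X ∣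
            t  = roundDown (d k) a
            a≤k = ℕₚ.m+n≤o⇒m≤o a ∣X∣+∣Y∣≤k
            t≤a = roundDown≤ (d k) a
            X′ , X′⊆X , ∣X′∣≤t , p = trim-loss X Y ℕₚ.≤-refl t≤a k≤2a (≤d+roundDown (d k) a)
        in f (Y ∪ X′)
         , subst (λ S → ι k * f S ≤ ι k * f (Y ∪ X′) + (δ + δ) * f S) (∪-comm Y X) p
         , subst (λ S → f S + f S ≤ v + (v + v)) (∪-comm X′ Y)
             -- The guess is `t`: Alice's budget shrinks to it, while Bob's budget `k ∸ t` only
             -- grows, so `Y` stays whole.
             (2f≤3v (roundDown∈grid (d k) a≤k) (ℕₚ.≤-trans t≤a a≤k)
               (λ x∈ → X⊆ (X′⊆X x∈)) Y⊆ ∣X′∣≤t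
               (ℕₚ.≤-trans ∣Y∣≤k∸∣X∣ (ℕₚ.∸-monoʳ-≤ k t≤a)))

      trim-Y : ∣ X ∣ +ℕ ∣ X ∣ ≤ℕ k → ∃ Approximated
      trim-Y 2a≤k =
        let a  = ∣ X ∣
            a≤k = ℕₚ.m+n≤o⇒m≤o a ∣X∣+∣Y∣≤k
            s  = k ∸ a
            t  = roundDown (d k) s
            t≤s = roundDown≤ (d k) s
            s≤k = ℕₚ.m∸n≤m k a
            t≤k = ℕₚ.≤-trans t≤s s≤k
            a≤s = ℕₚ.m+n≤o⇒m≤o∸n a 2a≤k
            k≤2s = ℕₚ.≤-trans (ℕₚ.≤-reflexive (sym (ℕₚ.m+[n∸m]≡n a≤k))) (ℕₚ.+-monoˡ-≤ s a≤s)
            Y′ , Y′⊆Y , ∣Y′∣≤t , p = trim-loss Y X ∣Y∣≤k∸∣X∣ t≤s k≤2s (≤d+roundDown (d k) s)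
        in f (X ∪ Y′)
         , p
         -- The guess is `k ∸ t`, which leaves Bob exactly `t`. It still covers `X`, because
         -- `t ≤ k ∸ ∣ X ∣`.
         , 2f≤3v (k∸roundDown∈grid (d k) s≤k)
             (ℕₚ.m∸n≤m k t) X⊆ (λ x∈ → Y⊆ (Y′⊆Y x∈))
             (ℕₚ.≤-trans (ℕₚ.≤-reflexive (sym (ℕₚ.m∸[m∸n]≡n a≤k))) (ℕₚ.∸-monoʳ-≤ k t≤s))
             (ℕₚ.≤-trans ∣Y′∣≤t (ℕₚ.≤-reflexive (sym (ℕₚ.m∸[m∸n]≡n t≤k))))

    T∩∁V-A⊆V-B : ∀ {T} → T ⊆ V-A ∪ V-B → T ∩ ∁ V-A ⊆ V-B
    T∩∁V-A⊆V-B {T} T⊆ x∈ with x∈T , x∈∁ ← x∈p∩q⁻ T (∁ V-A) x∈ with x∈p∪q⁻ V-A V-B (T⊆ x∈T)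
    ... | inj₁ x∈V-A = contradiction x∈V-A (x∈∁p⇒x∉p x∈∁)
    ... | inj₂ x∈V-B = x∈V-B

    -- `T` is split into its part in `V-A` and the rest. The trimming estimate is doubled so that
    -- `g + g ≤ v + (v + v)` can be inserted, which doubles the loss to `4δ`.
    approximation : ∀ {T} → Feasible T →
      ι k * (f T + f T) ≤ ι k * (v + (v + v)) + ((δ + δ) + (δ + δ)) * f T
    approximation {T} (T⊆ , ∣T∣≤k) = double
      (subst (λ S → ∃ λ g → ι k * f S ≤ ι k * g + (δ + δ) * f S × g + g ≤ v + (v + v)) recombine
        (split-approximation (T ∩ V-A) (T ∩ ∁ V-A) (p∩q⊆q T V-A) (T∩∁V-A⊆V-B T⊆)
          (subst (_≤ℕ k) (sym (∣p∩q∣+∣p∩∁q∣≡∣p∣ T V-A)) ∣T∣≤k)))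
      where
      open Solver

      recombine : (T ∩ V-A) ∪ (T ∩ ∁ V-A) ≡ T
      recombine = ⊆-antisym (∪-lub (p∩q⊆p T V-A) (p∩q⊆p T (∁ V-A))) (p⊆[p∩q]∪[p∩∁q] T V-A)

      double : (∃ λ g → ι k * f T ≤ ι k * g + (δ + δ) * f T × g + g ≤ v + (v + v)) →
        ι k * (f T + f T) ≤ ι k * (v + (v + v)) + ((δ + δ) + (δ + δ)) * f T
      double (g , p , q) = begin
        ι k * (f T + f T)
          ≡⟨ distribˡ (ι k) (f T) (f T) ⟩
        ι k * f T + ι k * f T
          ≤⟨ +-mono-≤ p p ⟩
        (ι k * g + (δ + δ) * f T) + (ι k * g + (δ + δ) * f T)
          ≡⟨ solve 4 (λ κ g a F → (κ :* g :+ a :* F) :+ (κ :* g :+ a :* F) := κ :* (g :+ g) :+ (a :+ a) :* F)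
               refl (ι k) g (δ + δ) (f T) ⟩
        ι k * (g + g) + ((δ + δ) + (δ + δ)) * f T
          ≤⟨ +-monoˡ-≤ _ (*-monoˡ-≤ (ι k) (0≤ι k) q) ⟩
        ι k * (v + (v + v)) + ((δ + δ) + (δ + δ)) * f T
          ∎

  2x≤3y⇒⅔x≤y : ∀ {x y} → x + x ≤ y + (y + y) → 2/3 * x ≤ y
  2x≤3y⇒⅔x≤y {x} {y} p = *-cancelˡ-≤ (ι 3) 0<3 (begin
    ι 3 * (2/3 * x)                ≡⟨ solve 4 (λ a b c x → a :* (b :* c :* x) := (a :* c) :* (b :* x)) refl (ι 3) (ι 2) (ι 3 ⁻¹) x ⟩
    (ι 3 * ι 3 ⁻¹) * (ι 2 * x)     ≡⟨ cong (_* (ι 2 * x)) (⁻¹-inverse (proj₂ 0<3 ∘ sym)) ⟩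
    1# * (ι 2 * x)                 ≡⟨ solve 1 (λ x → con 1 :* ((con 1 :+ (con 1 :+ con 0)) :* x) := x :+ x) refl x ⟩
    x + x                          ≤⟨ p ⟩
    y + (y + y)                    ≡⟨ solve 1 (λ y → y :+ (y :+ y) := (con 1 :+ (con 1 :+ (con 1 :+ con 0))) :* y) refl y ⟩
    ι 3 * y                        ∎)
    where
    open Solver
    0<3 = 0<ι {3} (s≤s z≤n)

  -- The error of `3ε` times `x` is spread evenly over the three copies of `y`, and the exact
  -- version is applied to `y + ε * x`.
  [⅔-ε]x≤y : ∀ ε {x y} → x + x ≤ y + (y + y) + (ε + (ε + ε)) * x → (2/3 - ε) * x ≤ y
  [⅔-ε]x≤y ε {x} {y} p = +-cancelʳ-≤ (ε * x) (begin
    (2/3 - ε) * x + ε * x   ≡⟨ sym (distribʳ x (2/3 - ε) ε) ⟩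
    (2/3 - ε + ε) * x       ≡⟨ cong (_* x) (x-z+z≡x 2/3 ε) ⟩
    2/3 * x                 ≤⟨ 2x≤3y⇒⅔x≤y (≤-trans p (≤-reflexive
                                 (solve 3 (λ y ε x → y :+ (y :+ y) :+ (ε :+ (ε :+ ε)) :* x
                                   := (y :+ ε :* x) :+ ((y :+ ε :* x) :+ (y :+ ε :* x))) refl y ε x))) ⟩
    y + ε * x               ∎)
    where open Solver

  -- With unit spacing the loss `δ` is `ι 0`, so the error term vanishes and the factor `ι k`
  -- cancels.
  exact-guarantee : HasApproximationGuarantee (protocol (grid 0)) 2/3
  exact-guarantee G I opt ((T , T-feasible , refl) , _) =
    subst (2/3 * f T ≤_) (sym (expectedValue≡v (λ _ → 0) G I))
      (2x≤3y⇒⅔x≤y (*-cancelˡ-≤ (ι k) (0<ι k>0) (≤-trans (approximation (λ _ → 0) G I T-feasible)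
        (≤-reflexive (solve 2 (λ a F → a :+ ((con 0 :+ con 0) :+ (con 0 :+ con 0)) :* F := a) refl _ (f T))))))
    where
    open Solver
    open Global G
    open Instance I

  exact-communication : HasCommunicationAtMost (protocol (grid 0)) (λ k → ι (8 *ℕ k ^ 2))
  exact-communication = communication (grid 0) _ (grid≤ 0) λ k 0<k → ι-mono-≤ (bound k 0<k)
    where
    bound : ∀ k → 0 ℕ.< k → length (grid 0 k) *ℕ (k +ℕ k) ≤ℕ 8 *ℕ k ^ 2
    bound k 0<k = ℕ≤.begin
      length (grid 0 k) *ℕ (k +ℕ k)             ℕ≤.≡⟨ cong (_*ℕ (k +ℕ k)) (trans (length-grid 0 k) (cong (λ q → suc q +ℕ suc q) (n/1≡n k))) ⟩
      -- The constant 8: there are `2(k + 1) ≤ 4k` guesses, by `k ≥ 1`, each costing at most `2k`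
      -- elements.
      (suc k +ℕ suc k) *ℕ (k +ℕ k)              ℕ≤.≤⟨ ℕₚ.*-monoˡ-≤ (k +ℕ k) (ℕₚ.+-mono-≤ (ℕₚ.+-monoˡ-≤ k 0<k) (ℕₚ.+-monoˡ-≤ k 0<k)) ⟩
      ((k +ℕ k) +ℕ (k +ℕ k)) *ℕ (k +ℕ k)        ℕ≤.≡⟨ ℕS.solve 1 (λ k → ((k ℕS.:+ k) ℕS.:+ (k ℕS.:+ k)) ℕS.:* (k ℕS.:+ k) ℕS.:= ℕS.con 8 ℕS.:* (k ℕS.:^ 2)) refl k ⟩
      8 *ℕ k ^ 2                                ℕ≤.∎
      where
      module ℕ≤ = ℕₚ.≤-Reasoning
      module ℕS = ℕSolver.+-*-Solver

  -- Guesses spaced proportionally to `ε * ι k`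

  module _ (ε : ℝ) (0<ε : 0# < ε) where

    private
      0≤ε : 0# ≤ ε
      0≤ε = proj₁ 0<ε

      0<2 : 0# < ι 2
      0<2 = 0<ι {2} (s≤s z≤n)

      ε/2 : ℝ
      ε/2 = ε * ι 2 ⁻¹

      ε/2+ε/2≡ε : ε/2 + ε/2 ≡ ε
      ε/2+ε/2≡ε = trans
        (solve 2 (λ e i → e :* i :+ e :* i := e :* ((con 1 :+ (con 1 :+ con 0)) :* i)) refl ε (ι 2 ⁻¹))
        (trans (cong (ε *_) (⁻¹-inverse (proj₂ 0<2 ∘ sym))) (*-identityʳ ε))
        where open Solver

      0≤ε/2 : 0# ≤ ε/2
      0≤ε/2 = *-cancelˡ-≤ (ι 2) 0<2 (begin
        ι 2 * 0#   ≡⟨ zeroʳ (ι 2) ⟩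
        0#         ≤⟨ 0≤ε ⟩
        ε          ≡⟨ sym ε/2+ε/2≡ε ⟩
        ε/2 + ε/2  ≡⟨ solve 1 (λ h → h :+ h := (con 1 :+ (con 1 :+ con 0)) :* h) refl ε/2 ⟩
        ι 2 * ε/2  ∎)
        where open Solver

    -- The actual spacing `suc (step k)` is the maximum of 1 and `⌈ ε/2 * ι k ⌉`. It is at least
    -- `εk / 2`, so there are few guesses, while the rounding loss `step k` is at most `εk / 2`.
    step : ℕ → ℕ
    step k = pred ⌈ ε/2 * ι k ⌉

    εk/2≤1+step : ∀ k → ε/2 * ι k ≤ ι (suc (step k))
    εk/2≤1+step k = ≤-trans (x≤⌈x⌉ (ε/2 * ι k)) (ι-mono-≤ (n≤1+pred ⌈ ε/2 * ι k ⌉))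
      where
      n≤1+pred : ∀ n → n ≤ℕ suc (pred n)
      n≤1+pred zero    = z≤n
      n≤1+pred (suc n) = ℕₚ.≤-refl

    -- In the opposite case, minimality bounds the ceiling by its own predecessor. Then the ceiling
    -- is 0, and so is the step.
    step≤εk/2 : ∀ k → ι (step k) ≤ ε/2 * ι k
    step≤εk/2 k with total (ι (step k)) (ε/2 * ι k)
    ... | inj₁ p = p
    ... | inj₂ p = subst (λ m → ι m ≤ ε/2 * ι k) (sym (n≤pred⇒pred≡0 _ (⌈⌉-least _ _ p)))
                     (*-nonNegative 0≤ε/2 (0≤ι k))
      where
      n≤pred⇒pred≡0 : ∀ n → n ≤ℕ pred n → pred n ≡ 0
      n≤pred⇒pred≡0 zero    _   = refl
      n≤pred⇒pred≡0 (suc n) n<n = contradiction n<n ℕₚ.1+n≰n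

    stepped : ℕ → List ℕ
    stepped k = grid (step k) k

    stepped-guarantee : HasApproximationGuarantee (protocol stepped) (2/3 - ε)
    stepped-guarantee G I opt ((T , T-feasible , refl) , _) =
      subst ((2/3 - ε) * F ≤_) (sym (expectedValue≡v step G I))
        ([⅔-ε]x≤y ε (*-cancelˡ-≤ (ι k) (0<ι k>0) (begin
          ι k * (F + F)
            ≤⟨ approximation step G I T-feasible ⟩
          ι k * w + ((δ + δ) + (δ + δ)) * F
            ≤⟨ +-monoʳ-≤ (ι k * w) (*-monoʳ-≤ F (nonNegative T) (+-mono-≤ 2δ≤ 2δ≤)) ⟩
          ι k * w + (ε * ι k + ε * ι k) * F
            ≡⟨ solve 4 (λ κ w e F → κ :* w :+ (e :* κ :+ e :* κ) :* F := κ :* (w :+ (e :+ e) :* F))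
                 refl (ι k) w ε F ⟩
          ι k * (w + (ε + ε) * F)
            ≤⟨ *-monoˡ-≤ (ι k) (0≤ι k) (+-monoʳ-≤ w (*-monoʳ-≤ F (nonNegative T) 2ε≤3ε)) ⟩
          ι k * (w + (ε + (ε + ε)) * F)
            ∎)))
      where
      open Solver
      open Global G
      open Instance I
      F = f T
      δ = ι (step k)
      w = v step G I + (v step G I + v step G I)

      2δ≤ : δ + δ ≤ ε * ι k
      2δ≤ = begin
        δ + δ                       ≤⟨ +-mono-≤ (step≤εk/2 k) (step≤εk/2 k) ⟩
        ε/2 * ι k + ε/2 * ι k       ≡⟨ sym (distribʳ (ι k) ε/2 ε/2) ⟩
        (ε/2 + ε/2) * ι k           ≡⟨ cong (_* ι k) ε/2+ε/2≡ε ⟩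
        ε * ι k                     ∎

      -- The loss `4δ` amounts to `2ε`, while the factor `2/3 - ε` tolerates `3ε`.
      2ε≤3ε : ε + ε ≤ ε + (ε + ε)
      2ε≤3ε = subst (_≤ ε + (ε + ε)) (+-identityˡ (ε + ε)) (+-monoˡ-≤ (ε + ε) 0≤ε)

    -- With `q` the quotient of `k` by the spacing, `2(q + 1)` guesses cost at most `2k` elements
    -- each. As `ε(q + 1) ≤ 3`, this gives the constant 12; the exponent 0 means that there is no
    -- logarithmic factor.
    bound : ℕ → ℝ
    bound k = polylogBound 12 0 (ι k / ε)

    ε*bound : ∀ k → ε * bound k ≡ ι 12 * ι k
    ε*bound k = trans
      (solve 4 (λ e c κ i → e :* (c :* (κ :* i) :* (con 1 :+ con 0)) := (e :* i) :* (c :* κ))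
        refl ε (ι 12) (ι k) (ε ⁻¹))
      (trans (cong (_* (ι 12 * ι k)) (⁻¹-inverse (proj₂ 0<ε ∘ sym))) (*-identityˡ (ι 12 * ι k)))
      where open Solver

    -- Everything is multiplied by `ε` to avoid the division in `bound`. The assumption `ε ≤ 1#`
    -- pays for the additive 1 in the number of guesses.
    stepped-communication : ε ≤ 1# → HasCommunicationAtMost (protocol stepped) bound
    stepped-communication ε≤1 = communication stepped bound (λ k → grid≤ (step k) k) λ k 0<k →
      *-cancelˡ-≤ ε 0<ε (begin
        ε * ι (length (stepped k) *ℕ (k +ℕ k))
          ≡⟨ cong (λ l → ε * ι (l *ℕ (k +ℕ k))) (length-grid (step k) k) ⟩
        ε * ι ((suc (q k) +ℕ suc (q k)) *ℕ (k +ℕ k))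
          ≡⟨ cong (ε *_) (trans (ι-* (suc (q k) +ℕ suc (q k)) (k +ℕ k))
               (cong₂ _*_ (ι-+ (suc (q k)) (suc (q k))) (ι-+ k k))) ⟩
        ε * ((ι (suc (q k)) + ι (suc (q k))) * (ι k + ι k))
          ≡⟨ solve 3 (λ e q κ → e :* (((con 1 :+ q) :+ (con 1 :+ q)) :* (κ :+ κ))
               := (e :+ e :* q) :* ((con 1 :+ (con 1 :+ (con 1 :+ (con 1 :+ con 0)))) :* κ)) refl ε (ι (q k)) (ι k) ⟩
        (ε + ε * ι (q k)) * (ι 4 * ι k)
          ≤⟨ *-monoʳ-≤ (ι 4 * ι k) (*-nonNegative (0≤ι 4) (0≤ι k)) (+-mono-≤ ε≤1 (εq≤2 k 0<k)) ⟩
        ι 3 * (ι 4 * ι k)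
          ≡⟨ trans (sym (*-assoc (ι 3) (ι 4) (ι k))) (cong (_* ι k) (sym (ι-* 3 4))) ⟩
        ι 12 * ι k
          ≡⟨ sym (ε*bound k) ⟩
        ε * bound k
          ∎)
      where
      open Solver
      q : ℕ → ℕ
      q k = k /ℕ suc (step k)

      -- `q k` spacings fit into `k`, and each has length at least `εk / 2`.
      εq/2≤1 : ∀ k → 0 ℕ.< k → ε/2 * ι (q k) ≤ 1#
      εq/2≤1 k 0<k = *-cancelˡ-≤ (ι k) (0<ι 0<k) (begin
        ι k * (ε/2 * ι (q k))         ≡⟨ solve 3 (λ κ e q → κ :* (e :* q) := q :* (e :* κ)) refl (ι k) ε/2 (ι (q k)) ⟩
        ι (q k) * (ε/2 * ι k)         ≤⟨ *-monoˡ-≤ (ι (q k)) (0≤ι (q k)) (εk/2≤1+step k) ⟩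
        ι (q k) * ι (suc (step k))    ≡⟨ sym (ι-* (q k) (suc (step k))) ⟩
        ι (q k *ℕ suc (step k))       ≤⟨ ι-mono-≤ (m/n*n≤m k (suc (step k))) ⟩
        ι k                           ≡⟨ sym (*-identityʳ (ι k)) ⟩
        ι k * 1#                      ∎)

      εq≤2 : ∀ k → 0 ℕ.< k → ε * ι (q k) ≤ ι 2
      εq≤2 k 0<k = begin
        ε * ι (q k)                       ≡⟨ cong (_* ι (q k)) (sym ε/2+ε/2≡ε) ⟩
        (ε/2 + ε/2) * ι (q k)             ≡⟨ distribʳ (ι (q k)) ε/2 ε/2 ⟩
        ε/2 * ι (q k) + ε/2 * ι (q k)     ≤⟨ +-mono-≤ (εq/2≤1 k 0<k) (≤-trans (εq/2≤1 k 0<k) (≤-reflexive (sym ι1≡1))) ⟩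
        ι 2                               ∎

    -- For `ε ≥ 1` the required factor is negative, so any non-negative value suffices, whereas the
    -- communication bound shrinks to 0 as `ε` grows. Hence Alice sends nothing.
    silent : ℕ → List ℕ
    silent _ = []

    silent-guarantee : 1# ≤ ε → HasApproximationGuarantee (protocol silent) (2/3 - ε)
    silent-guarantee 1≤ε G I opt ((T , _ , refl) , _) =
      subst ((2/3 - ε) * f T ≤_) (sym expectedValue≡u) ([⅔-ε]x≤y ε (begin
        f T + f T                         ≡⟨ solve 1 (λ F → F :+ F := con 0 :+ (con 0 :+ (con 1 :+ con 1)) :* F) refl (f T) ⟩
        -- Of the three copies of `ε`, two are at least 1 and already pay for `f T + f T`; the third
        -- is bounded below by 0.
        0# + (0# + (1# + 1#)) * f T       ≤⟨ +-mono-≤ 0≤3u (*-monoʳ-≤ (f T) (nonNegative T)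
                                               (+-mono-≤ 0≤ε (+-mono-≤ 1≤ε 1≤ε))) ⟩
        u + (u + u) + (ε + (ε + ε)) * f T ∎))
      where
      open Solver
      open Instance I
      open Analysis silent G I using () renaming (v to u; expectedValue≡v to expectedValue≡u)

      0≤3u : 0# ≤ u + (u + u)
      0≤3u = subst (_≤ u + (u + u)) (solve 0 (con 0 :+ (con 0 :+ con 0) := con 0) refl)
        (+-mono-≤ (nonNegative _) (+-mono-≤ (nonNegative _) (nonNegative _)))

    silent-communication : HasCommunicationAtMost (protocol silent) bound
    silent-communication = communication silent bound (λ _ → []) λ k _ →
      *-cancelˡ-≤ ε 0<ε (begin
        ε * 0#       ≡⟨ zeroʳ ε ⟩
        0#           ≤⟨ *-nonNegative (0≤ι 12) (0≤ι k) ⟩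
        ι 12 * ι k   ≡⟨ sym (ε*bound k) ⟩
        ε * bound k  ∎)

    approximate : ∃ λ (Π : Protocol) →
      HasApproximationGuarantee Π (2/3 - ε) × HasCommunicationAtMost Π bound
    approximate with total ε 1#
    ... | inj₁ ε≤1 = protocol stepped , stepped-guarantee , stepped-communication ε≤1
    ... | inj₂ 1≤ε = protocol silent , silent-guarantee 1≤ε , silent-communication

theorem1 : (R : RealNumbers) → let open RealNumbers R in let open TwoPlayer R in
    (∃₂ λ (C c : ℕ) → ∀ (ε : ℝ) → 0# < ε →
      ∃ λ (Π : Protocol) →
        HasApproximationGuarantee Π (2/3 - ε) ×
        HasCommunicationAtMost Π (λ k → polylogBound C c (ι k / ε)))
    ×
    (∃ λ (C : ℕ) → ∃ λ (Π : Protocol) →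
        HasApproximationGuarantee Π 2/3 ×
        HasCommunicationAtMost Π (λ k → ι (C *ℕ k ^ 2)))
theorem1 R = (12 , 0 , approximate) , 8 , protocol (grid 0) , exact-guarantee , exact-communication
  where
  open SketchProtocol R
  open Guarantees R
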